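{- For every constraint list $C$ and every substitution $\sigma$: if $\mathsf{unify}(C) = \sigma$, then $\sigma \models C$.
   Context: Types: fix a set of type variables (with decidable equality), ranged over by $\alpha,\beta,\dots$. Types are generated by $\tau ::= \alpha \mid \tau_1 \rightarrow \tau_2$. Free variables of a type (a list): $\mathsf{FTV}(\alpha) = [\alpha]$, $\mathsf{FTV}(\tau\rightarrow\tau') = \mathsf{FTV}(\tau) \mathbin{+\!\!+} \mathsf{FTV}(\tau')$, where $+\!\!+$ is list append. "$\alpha$ occurs in $\tau$" means $\alpha\in\mathsf{FTV}(\tau)$. Constraints: a constraint is a formal equation $\tau \stackrel{\rm e}{=} \tau'$ between types; a constraint list is a finite list of constraints. Substitutions: a substitution $\sigma$ is a finite map (finite partial function) from type variables to types. $\sigma_{\mathbb{E}}$ is the empty finite map and $\{\alpha\mapsto\tau\}$ the map whose only binding sends $\alpha$ to $\tau$. Application: $\sigma(\alpha)=\tau$ if $\langle\alpha,\tau\rangle\in\sigma$, $\sigma(\alpha)=\alpha$ if $\alpha$ is not bound by $\sigma$; $\sigma(\tau_1\rightarrow\tau_2)=\sigma(\tau_1)\rightarrow\sigma(\tau_2)$; $\sigma(\tau_1\stackrel{\rm e}{=}\tau_2) = (\sigma(\tau_1)\stackrel{\rm e}{=}\sigma(\tau_2))$; and $\sigma(C)$ is obtained by applying $\sigma$ to each constraint in the list $C$. Composition: $\sigma\circ\sigma'$ is the finite map that binds $\alpha$ to $\sigma'(\tau)$ if $\langle\alpha,\tau\rangle\in\sigma$; binds $\alpha$ to $\tau'$ if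 $\alpha$ is not bound by $\sigma$ and $\langle\alpha,\tau'\rangle\in\sigma'$; and leaves $\alpha$ unbound otherwise. Satisfaction: $\sigma\models(\tau_1\stackrel{\rm e}{=}\tau_2)$ means $\sigma(\tau_1)=\sigma(\tau_2)$; $\sigma\models C$ means $\sigma$ satisfies every constraint in $C$. Unification: $\mathsf{unify}$ takes a constraint list and either fails ($\mathsf{None}$) or succeeds with a substitution ($\mathsf{Some}\;\sigma$); "$\mathsf{unify}(C)=\sigma$" means that it succeeds with result exactly $\sigma$. It is defined by (with $\tau$ a non-variable type in the third and fourth clauses, and failure of a recursive call propagating): (1) $\mathsf{unify}([\,]) = \sigma_{\mathbb{E}}$; (2) $\mathsf{unify}((\alpha\stackrel{\rm e}{=}\beta)::C) = \mathsf{unify}(C)$ if $\alpha=\beta$, else $\{\alpha\mapsto\beta\}\circ\mathsf{unify}(\{\alpha\mapsto\beta\}(C))$; (3) $\mathsf{unify}((\alpha\stackrel{\rm e}{=}\tau)::C)$ fails if $\alpha$ occurs in $\tau$, else is $\{\alpha\mapsto\tau\}\circ\mathsf{unify}(\{\alpha\mapsto\tau\}(C))$; (4) $\mathsf{unify}((\tau\stackrel{\rm e}{=}\alpha)::C)$ fails if $\alpha$ occurs in $\tau$, else is $\{\alpha\mapsto\tau\}\circ\mathsf{unify}(\{\alpha\mapsto\tau\}(C))$; (5) $\mathsf{unify}((\tau_1\rightarrow\tau_2\stackrel{\rm e}{=}\tau_3\rightarrow\tau_4)::C) = \mathsf{unify}((\tau_1\stackrel{\rm e}{=}\tau_3)::(\tau_2\stackrel{\rm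 e}{=}\tau_4)::C)$. This is a total function by well-founded recursion on the lexicographically ordered triple (number of distinct variables in the list, total number of arrows in the list, length of the list). -}

module Defs where

open import Data.List.Base using (List; []; _∷_; _++_; map; concatMap; deduplicate; length; [_])
open import Data.List.Membership.Propositional using (_∈_; _∉_)
open import Data.List.Membership.Propositional.Properties
  using (∈-++⁺ˡ; ∈-++⁺ʳ; ∈-++⁻; ∈-∃++; ∈-deduplicate⁺; ∈-deduplicate⁻)
open import Data.List.Properties using (length-++)
open import Data.List.Relation.Binary.Subset.Propositional using (_⊆_)
open import Data.List.Relation.Unary.All as All using (All; []; _∷_)
open import Data.List.Relation.Unary.All.Properties using (¬Any⇒All¬)
open import Data.List.Relation.Unary.AllPairs using ([]; _∷_)
open import Data.List.Relation.Unary.Any using (here; there)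
open import Data.List.Relation.Unary.Unique.Propositional using (Unique)
open import Data.Maybe.Base as Maybe using (Maybe; just; nothing; fromMaybe; _<∣>_)
open import Data.Nat.Base using (ℕ; suc; _+_; _≤_; _<_; z≤n; s≤s)
open import Data.Nat.Induction using (<-wellFounded)
open import Data.Nat.ListAction using (sum)
open import Data.Nat.Properties
  using (≤-refl; m≤n⇒m<n∨m≡n; m≤n+m; +-suc; module ≤-Reasoning)
open import Data.Nat.Solver using (module +-*-Solver)
open import Data.Product.Base using (_×_; _,_; proj₁; proj₂)
open import Data.Product.Relation.Binary.Lex.Strict using (×-Lex; ×-wellFounded)
open import Data.Sum.Base using (_⊎_; inj₁; inj₂)
open import Induction.WellFounded using (Acc; acc; WellFounded; module Subrelation)
open import Relation.Binary.Core using (Rel)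
open import Relation.Binary.Definitions using (DecidableEquality)
import Relation.Binary.Construct.On as On
open import Relation.Binary.PropositionalEquality
  using (_≡_; _≢_; refl; cong; subst)
open import Relation.Nullary.Decidable using (yes; no)
open import Relation.Nullary.Negation using (contradiction)

Unique-⊆⇒length≤ : ∀ {A : Set} {xs ys : List A} → Unique xs → xs ⊆ ys → length xs ≤ length ys
Unique-⊆⇒length≤ [] _ = z≤n
Unique-⊆⇒length≤ {xs = x ∷ xs} (x∉ ∷ u) xs⊆ys with ∈-∃++ (xs⊆ys (here refl))
... | as , bs , refl = begin
  suc (length xs)             ≤⟨ s≤s (Unique-⊆⇒length≤ u without-x) ⟩
  suc (length (as ++ bs))     ≡⟨ cong suc (length-++ as) ⟩
  suc (length as + length bs) ≡⟨ +-suc (length as) (length bs) ⟨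
  length as + length (x ∷ bs) ≡⟨ length-++ as ⟨
  length (as ++ x ∷ bs)       ∎
  where
  open ≤-Reasoning
  without-x : xs ⊆ as ++ bs
  without-x z∈xs with ∈-++⁻ as (xs⊆ys (there z∈xs))
  ... | inj₁ z∈as         = ∈-++⁺ˡ z∈as
  ... | inj₂ (here refl)  = contradiction refl (All.lookup x∉ z∈xs)
  ... | inj₂ (there z∈bs) = ∈-++⁺ʳ as z∈bs

module Unification {Var : Set} (_≟_ : DecidableEquality Var) where

  open import Data.List.Membership.DecPropositional _≟_ using (_∈?_)
  open import Data.List.Relation.Unary.Unique.DecPropositional.Properties _≟_
    using (deduplicate-!)

  infixr 6 _⇒_
  infix  5 _≐_
  infix  4 _≈_ _⊨ᶜ_ _⊨_ _≺_
  infixr 9 _⊙_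

  data Type : Set where
    var : Var → Type
    _⇒_ : Type → Type → Type

  FTV : Type → List Var
  FTV (var α)  = [ α ]
  FTV (τ ⇒ τ′) = FTV τ ++ FTV τ′

  data Constraint : Set where
    _≐_ : Type → Type → Constraint

  -- A finite partial function: `support` is any finite list covering the domain
  -- of `lookup`; it may contain repetitions and unbound variables.
  record Substitution : Set where
    field
      lookup  : Var → Maybe Type
      support : List Var
      finite  : ∀ α {τ} → lookup α ≡ just τ → α ∈ support

  open Substitution public

  -- Equality of finite maps: same bindings, whatever the covering lists.
  _≈_ : Rel Substitution _
  σ ≈ σ′ = ∀ α → lookup σ α ≡ lookup σ′ α

  ∅ : Substitution
  ∅ = record { lookup = λ _ → nothing ; support = [] ; finite = λ _ () }

  _↦_ : Var → Type → Substitution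
  α ↦ τ = record { lookup = look ; support = [ α ] ; finite = fin }
    where
    look : Var → Maybe Type
    look β with α ≟ β
    ... | yes _ = just τ
    ... | no  _ = nothing
    fin : ∀ β {τ′} → look β ≡ just τ′ → β ∈ [ α ]
    fin β eq with α ≟ β
    fin β _  | yes refl = here refl
    fin β () | no _

  apply : Substitution → Type → Type
  apply σ (var α)   = fromMaybe (var α) (lookup σ α)
  apply σ (τ₁ ⇒ τ₂) = apply σ τ₁ ⇒ apply σ τ₂

  applyᶜ : Substitution → Constraint → Constraint
  applyᶜ σ (τ₁ ≐ τ₂) = apply σ τ₁ ≐ apply σ τ₂

  applyᴸ : Substitution → List Constraint → List Constraint
  applyᴸ σ = map (applyᶜ σ)

  -- Composition in diagrammatic order: σ acts first, then σ′.
  _⊙_ : Substitution → Substitution → Substitution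
  σ ⊙ σ′ = record { lookup = look ; support = support σ ++ support σ′ ; finite = fin }
    where
    look : Var → Maybe Type
    look α = Maybe.map (apply σ′) (lookup σ α) <∣> lookup σ′ α
    fin : ∀ α {τ} → look α ≡ just τ → α ∈ support σ ++ support σ′
    fin α eq with lookup σ α in eqσ
    ... | just _  = ∈-++⁺ˡ (finite σ α eqσ)
    ... | nothing = ∈-++⁺ʳ (support σ) (finite σ′ α eq)

  _⊨ᶜ_ : Substitution → Constraint → Set
  σ ⊨ᶜ (τ₁ ≐ τ₂) = apply σ τ₁ ≡ apply σ τ₂

  _⊨_ : Substitution → List Constraint → Set
  σ ⊨ C = All (σ ⊨ᶜ_) C

  FTVᶜ : Constraint → List Var
  FTVᶜ (τ₁ ≐ τ₂) = FTV τ₁ ++ FTV τ₂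

  FTVᴸ : List Constraint → List Var
  FTVᴸ = concatMap FTVᶜ

  arrows : Type → ℕ
  arrows (var _)   = 0
  arrows (τ₁ ⇒ τ₂) = suc (arrows τ₁ + arrows τ₂)

  arrowsᶜ : Constraint → ℕ
  arrowsᶜ (τ₁ ≐ τ₂) = arrows τ₁ + arrows τ₂

  #vars : List Constraint → ℕ
  #vars C = length (deduplicate _≟_ (FTVᴸ C))

  #arrows : List Constraint → ℕ
  #arrows C = sum (map arrowsᶜ C)

  measure : List Constraint → ℕ × ℕ × ℕ
  measure C = #vars C , #arrows C , length C

  _<ₗₑₓ_ : Rel (ℕ × ℕ × ℕ) _
  _<ₗₑₓ_ = ×-Lex _≡_ _<_ (×-Lex _≡_ _<_ _<_)

  -- A record rather than `_<ₗₑₓ_ on measure`, because the latter unfolds to tests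
  -- _≟_ on concrete lists, which get caught by `with α ≟ β` abstractions.
  record _≺_ (C D : List Constraint) : Set where
    constructor decreasing
    field measure-< : measure C <ₗₑₓ measure D

  ≺-wellFounded : WellFounded _≺_
  ≺-wellFounded = Subrelation.wellFounded _≺_.measure-< (On.wellFounded measure
    (×-wellFounded <-wellFounded (×-wellFounded <-wellFounded <-wellFounded)))

  #vars-mono : ∀ C D → FTVᴸ C ⊆ FTVᴸ D → #vars C ≤ #vars D
  #vars-mono C D C⊆D = Unique-⊆⇒length≤ (deduplicate-! (FTVᴸ C))
    λ z∈ → ∈-deduplicate⁺ _≟_ (C⊆D (∈-deduplicate⁻ _≟_ (FTVᴸ C) z∈))

  #vars-strict : ∀ {α} C D → α ∉ FTVᴸ C → α ∈ FTVᴸ D → FTVᴸ C ⊆ FTVᴸ D → #vars C < #vars D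
  #vars-strict {α} C D α∉C α∈D C⊆D =
    Unique-⊆⇒length≤
      (¬Any⇒All¬ _ (λ α∈ → α∉C (∈-deduplicate⁻ _≟_ (FTVᴸ C) α∈)) ∷ deduplicate-! (FTVᴸ C))
      λ { (here refl) → ∈-deduplicate⁺ _≟_ α∈D
        ; (there z∈)  → ∈-deduplicate⁺ _≟_ (C⊆D (∈-deduplicate⁻ _≟_ (FTVᴸ C) z∈)) }

  ≺-drop : ∀ c C → C ≺ c ∷ C
  ≺-drop c C with m≤n⇒m<n∨m≡n (#vars-mono C (c ∷ C) (∈-++⁺ʳ (FTVᶜ c)))
  ... | inj₁ v< = decreasing (inj₁ v<)
  ... | inj₂ v≡ with m≤n⇒m<n∨m≡n (m≤n+m (#arrows C) (arrowsᶜ c))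
  ...   | inj₁ a< = decreasing (inj₂ (v≡ , inj₁ a<))
  ...   | inj₂ a≡ = decreasing (inj₂ (v≡ , inj₂ (a≡ , ≤-refl)))

  -- Every variable left after α ↦ τ differs from α and comes from τ or the original.
  FTV-↦ : ∀ {α τ} → α ∉ FTV τ → ∀ τ′ {z} → z ∈ FTV (apply (α ↦ τ) τ′) →
          z ≢ α × (z ∈ FTV τ ⊎ z ∈ FTV τ′)
  FTV-↦ {α} α∉τ (var β) z∈ with α ≟ β
  ... | yes _ = (λ { refl → α∉τ z∈ }) , inj₁ z∈
  FTV-↦ α∉τ (var β) (here refl) | no α≢β = (λ { refl → α≢β refl }) , inj₂ (here refl)
  FTV-↦ {α} {τ} α∉τ (τ₁ ⇒ τ₂) z∈ with ∈-++⁻ (FTV (apply (α ↦ τ) τ₁)) z∈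
  ... | inj₁ z∈₁ with FTV-↦ α∉τ τ₁ z∈₁
  ...   | z≢ , inj₁ p = z≢ , inj₁ p
  ...   | z≢ , inj₂ p = z≢ , inj₂ (∈-++⁺ˡ p)
  FTV-↦ α∉τ (τ₁ ⇒ τ₂) z∈ | inj₂ z∈₂ with FTV-↦ α∉τ τ₂ z∈₂
  ...   | z≢ , inj₁ p = z≢ , inj₁ p
  ...   | z≢ , inj₂ p = z≢ , inj₂ (∈-++⁺ʳ (FTV τ₁) p)

  FTVᴸ-↦ : ∀ {α τ} → α ∉ FTV τ → ∀ C {z} → z ∈ FTVᴸ (applyᴸ (α ↦ τ) C) →
           z ≢ α × (z ∈ FTV τ ⊎ z ∈ FTVᴸ C)
  FTVᴸ-↦ {α} {τ} α∉τ ((τ₁ ≐ τ₂) ∷ C) z∈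
    with ∈-++⁻ (FTVᶜ (applyᶜ (α ↦ τ) (τ₁ ≐ τ₂))) z∈
  ... | inj₁ z∈c with FTV-↦ α∉τ (τ₁ ⇒ τ₂) z∈c
  ...   | z≢ , inj₁ p = z≢ , inj₁ p
  ...   | z≢ , inj₂ p = z≢ , inj₂ (∈-++⁺ˡ p)
  FTVᴸ-↦ α∉τ ((τ₁ ≐ τ₂) ∷ C) z∈ | inj₂ z∈C with FTVᴸ-↦ α∉τ C z∈C
  ...   | z≢ , inj₁ p = z≢ , inj₁ p
  ...   | z≢ , inj₂ p = z≢ , inj₂ (∈-++⁺ʳ (FTVᶜ (τ₁ ≐ τ₂)) p)

  ≺-substˡ : ∀ {α τ} → α ∉ FTV τ → ∀ C → applyᴸ (α ↦ τ) C ≺ (var α ≐ τ) ∷ C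
  ≺-substˡ {α} {τ} α∉τ C = decreasing (inj₁ (#vars-strict (applyᴸ (α ↦ τ) C) ((var α ≐ τ) ∷ C)
    (λ α∈ → proj₁ (FTVᴸ-↦ α∉τ C α∈) refl) (here refl) vars⊆))
    where
    vars⊆ : FTVᴸ (applyᴸ (α ↦ τ) C) ⊆ FTVᴸ ((var α ≐ τ) ∷ C)
    vars⊆ z∈ with proj₂ (FTVᴸ-↦ α∉τ C z∈)
    ... | inj₁ z∈τ = there (∈-++⁺ˡ z∈τ)
    ... | inj₂ z∈C = there (∈-++⁺ʳ (FTV τ) z∈C)

  ≺-substʳ : ∀ {α τ} → α ∉ FTV τ → ∀ C → applyᴸ (α ↦ τ) C ≺ (τ ≐ var α) ∷ C
  ≺-substʳ {α} {τ} α∉τ C = decreasing (inj₁ (#vars-strict (applyᴸ (α ↦ τ) C) ((τ ≐ var α) ∷ C)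
    (λ α∈ → proj₁ (FTVᴸ-↦ α∉τ C α∈) refl) (∈-++⁺ˡ (∈-++⁺ʳ (FTV τ) (here refl))) vars⊆))
    where
    vars⊆ : FTVᴸ (applyᴸ (α ↦ τ) C) ⊆ FTVᴸ ((τ ≐ var α) ∷ C)
    vars⊆ z∈ with proj₂ (FTVᴸ-↦ α∉τ C z∈)
    ... | inj₁ z∈τ = ∈-++⁺ˡ (∈-++⁺ˡ z∈τ)
    ... | inj₂ z∈C = ∈-++⁺ʳ (FTV τ ++ [ α ]) z∈C

  ≺-split : ∀ τ₁ τ₂ τ₃ τ₄ C →
            (τ₁ ≐ τ₃) ∷ (τ₂ ≐ τ₄) ∷ C ≺ (τ₁ ⇒ τ₂ ≐ τ₃ ⇒ τ₄) ∷ C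
  ≺-split τ₁ τ₂ τ₃ τ₄ C with m≤n⇒m<n∨m≡n (#vars-mono new old vars⊆)
    where
    new old : List Constraint
    new = (τ₁ ≐ τ₃) ∷ (τ₂ ≐ τ₄) ∷ C
    old = (τ₁ ⇒ τ₂ ≐ τ₃ ⇒ τ₄) ∷ C
    vars⊆ : FTVᴸ new ⊆ FTVᴸ old
    vars⊆ z∈ with ∈-++⁻ (FTV τ₁ ++ FTV τ₃) z∈
    ... | inj₁ z∈₁₃ with ∈-++⁻ (FTV τ₁) z∈₁₃
    ...   | inj₁ z∈₁ = ∈-++⁺ˡ (∈-++⁺ˡ (∈-++⁺ˡ z∈₁))
    ...   | inj₂ z∈₃ = ∈-++⁺ˡ (∈-++⁺ʳ (FTV τ₁ ++ FTV τ₂) (∈-++⁺ˡ z∈₃))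
    vars⊆ z∈ | inj₂ z∈′ with ∈-++⁻ (FTV τ₂ ++ FTV τ₄) z∈′
    ...   | inj₂ z∈C = ∈-++⁺ʳ (FTVᶜ (τ₁ ⇒ τ₂ ≐ τ₃ ⇒ τ₄)) z∈C
    ...   | inj₁ z∈₂₄ with ∈-++⁻ (FTV τ₂) z∈₂₄
    ...     | inj₁ z∈₂ = ∈-++⁺ˡ (∈-++⁺ˡ (∈-++⁺ʳ (FTV τ₁) z∈₂))
    ...     | inj₂ z∈₄ = ∈-++⁺ˡ (∈-++⁺ʳ (FTV τ₁ ++ FTV τ₂) (∈-++⁺ʳ (FTV τ₃) z∈₄))
  ... | inj₁ v< = decreasing (inj₁ v<)
  ... | inj₂ v≡ = decreasing (inj₂ (v≡ , inj₁ arrows<))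
    where
    open +-*-Solver
    regroup : ∀ a b c d n →
      suc (suc (a + c + (b + d + n))) ≡ suc (a + b) + suc (c + d) + n
    regroup = solve 5 (λ a b c d n →
      con 2 :+ (a :+ c :+ (b :+ d :+ n)) :=
      (con 1 :+ (a :+ b)) :+ (con 1 :+ (c :+ d)) :+ n) refl
    arrows< : #arrows ((τ₁ ≐ τ₃) ∷ (τ₂ ≐ τ₄) ∷ C) < #arrows ((τ₁ ⇒ τ₂ ≐ τ₃ ⇒ τ₄) ∷ C)
    arrows< = subst (#arrows ((τ₁ ≐ τ₃) ∷ (τ₂ ≐ τ₄) ∷ C) <_)
      (regroup (arrows τ₁) (arrows τ₂) (arrows τ₃) (arrows τ₄) (#arrows C))
      (s≤s (m≤n+m _ 1))

  var-∉ : ∀ {α β} → α ≢ β → α ∉ FTV (var β)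
  var-∉ α≢β (here α≡β) = α≢β α≡β

  unify-acc : (C : List Constraint) → Acc _≺_ C → Maybe Substitution
  unify-acc [] _ = just ∅
  unify-acc ((var α ≐ var β) ∷ C) (acc rs) with α ≟ β
  ... | yes _   = unify-acc C (rs (≺-drop (var α ≐ var β) C))
  ... | no  α≢β = Maybe.map ((α ↦ var β) ⊙_)
                    (unify-acc (applyᴸ (α ↦ var β) C) (rs (≺-substˡ (var-∉ α≢β) C)))
  unify-acc ((var α ≐ τ@(_ ⇒ _)) ∷ C) (acc rs) with α ∈? FTV τ
  ... | yes _   = nothing
  ... | no  α∉τ = Maybe.map ((α ↦ τ) ⊙_)
                    (unify-acc (applyᴸ (α ↦ τ) C) (rs (≺-substˡ α∉τ C)))
  unify-acc ((τ@(_ ⇒ _) ≐ var α) ∷ C) (acc rs) with α ∈? FTV τ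
  ... | yes _   = nothing
  ... | no  α∉τ = Maybe.map ((α ↦ τ) ⊙_)
                    (unify-acc (applyᴸ (α ↦ τ) C) (rs (≺-substʳ α∉τ C)))
  unify-acc ((τ₁ ⇒ τ₂ ≐ τ₃ ⇒ τ₄) ∷ C) (acc rs) =
    unify-acc ((τ₁ ≐ τ₃) ∷ (τ₂ ≐ τ₄) ∷ C) (rs (≺-split τ₁ τ₂ τ₃ τ₄ C))

  unify : List Constraint → Maybe Substitution
  unify C = unify-acc C (≺-wellFounded C)

{-# OPTIONS --safe #-}
module Submission where

open import Defs
open import Data.List.Base using (List; []; _∷_)
open import Data.List.Membership.Propositional using (_∉_)
open import Data.List.Membership.Propositional.Properties using (∈-++⁺ˡ; ∈-++⁺ʳ)
open import Data.List.Relation.Unary.All as All using ([]; _∷_)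
import Data.List.Relation.Unary.All.Properties as All
open import Data.List.Relation.Unary.Any using (here)
open import Data.Maybe.Base using (just; nothing; fromMaybe)
open import Data.Maybe.Relation.Binary.Pointwise using (Pointwise; just)
import Data.Maybe.Relation.Unary.All as Maybe
import Data.Maybe.Relation.Unary.All.Properties as Maybe
open import Function.Base using (_∘_)
open import Induction.WellFounded using (Acc; acc)
open import Relation.Binary.Definitions using (DecidableEquality)
open import Relation.Binary.PropositionalEquality
  using (_≡_; refl; sym; trans; cong; cong₂)
open import Relation.Nullary.Decidable using (yes; no)
open import Relation.Nullary.Negation using (contradiction)

-- Soundness follows by induction along the recursion of `unify`. The key case eliminates a
-- variable: the result is `(α ↦ τ) ⊙ σ`, where `σ` satisfies the tail after substitution. Applying
-- a composite means applying its factors in turn (`apply-⊙`), so the composite satisfies the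
-- original tail. It satisfies the head because the occurs check makes `α ↦ τ` send both `α` and `τ`
-- to `τ`. Splitting an arrow equation is sound because arrows with equal components are equal.

module Soundness {Var : Set} (_≟_ : DecidableEquality Var) where

  open Unification _≟_
  open import Data.List.Membership.DecPropositional _≟_ using (_∈?_)

  apply-cong : ∀ {σ σ′} → σ ≈ σ′ → ∀ τ → apply σ τ ≡ apply σ′ τ
  apply-cong σ≈σ′ (var α)   = cong (fromMaybe (var α)) (σ≈σ′ α)
  apply-cong σ≈σ′ (τ₁ ⇒ τ₂) = cong₂ _⇒_ (apply-cong σ≈σ′ τ₁) (apply-cong σ≈σ′ τ₂)

  -- A finite map may carry different covering lists, so results of `unify` are compared only up to
  -- `≈`; satisfaction has to transfer along it.
  ⊨ᶜ-resp-≈ : ∀ {σ σ′} → σ ≈ σ′ → ∀ c → σ ⊨ᶜ c → σ′ ⊨ᶜ c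
  ⊨ᶜ-resp-≈ σ≈σ′ (τ₁ ≐ τ₂) σ⊨ =
    trans (sym (apply-cong σ≈σ′ τ₁)) (trans σ⊨ (apply-cong σ≈σ′ τ₂))

  -- At a variable that `σ` leaves unbound, `⊙` falls back on `σ′`, which is what `σ′` does to a
  -- variable that `σ` has not moved.
  apply-⊙ : ∀ σ σ′ τ → apply (σ ⊙ σ′) τ ≡ apply σ′ (apply σ τ)
  apply-⊙ σ σ′ (var α) with lookup σ α
  ... | just _  = refl
  ... | nothing = refl
  apply-⊙ σ σ′ (τ₁ ⇒ τ₂) = cong₂ _⇒_ (apply-⊙ σ σ′ τ₁) (apply-⊙ σ σ′ τ₂)

  ⊨ᶜ-⊙ : ∀ σ σ′ c → σ′ ⊨ᶜ applyᶜ σ c → (σ ⊙ σ′) ⊨ᶜ c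
  ⊨ᶜ-⊙ σ σ′ (τ₁ ≐ τ₂) σ′⊨ =
    trans (apply-⊙ σ σ′ τ₁) (trans σ′⊨ (sym (apply-⊙ σ σ′ τ₂)))

  ⊨-⊙ : ∀ σ σ′ {C} → σ′ ⊨ applyᴸ σ C → (σ ⊙ σ′) ⊨ C
  ⊨-⊙ σ σ′ = All.map (λ {c} → ⊨ᶜ-⊙ σ σ′ c) ∘ All.map⁻

  apply-↦-≡ : ∀ α τ → apply (α ↦ τ) (var α) ≡ τ
  apply-↦-≡ α τ with α ≟ α
  ... | yes _   = refl
  ... | no  α≢α = contradiction refl α≢α

  apply-↦-∉ : ∀ {α τ} τ′ → α ∉ FTV τ′ → apply (α ↦ τ) τ′ ≡ τ′
  apply-↦-∉ {α} (var β) α∉ with α ≟ β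
  ... | yes α≡β = contradiction (here α≡β) α∉
  ... | no  _   = refl
  apply-↦-∉ (τ₁ ⇒ τ₂) α∉ =
    cong₂ _⇒_ (apply-↦-∉ τ₁ (α∉ ∘ ∈-++⁺ˡ)) (apply-↦-∉ τ₂ (α∉ ∘ ∈-++⁺ʳ (FTV τ₁)))

  -- `α ↦ τ` alone already solves the equation, since it fixes `τ` when `α` does not occur there;
  -- applying `σ` afterwards preserves the equality.
  ↦-⊙-⊨ᶜ : ∀ {α τ} → α ∉ FTV τ → ∀ σ → ((α ↦ τ) ⊙ σ) ⊨ᶜ (var α ≐ τ)
  ↦-⊙-⊨ᶜ {α} {τ} α∉τ σ =
    ⊨ᶜ-⊙ (α ↦ τ) σ (var α ≐ τ) (cong (apply σ) (trans (apply-↦-≡ α τ) (sym (apply-↦-∉ τ α∉τ))))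

  -- `Maybe.All` makes failure vacuous. Quantifying over every accessibility proof lets the
  -- induction hypothesis apply to the one passed to each recursive call.
  unify-acc-sound : ∀ C (C-acc : Acc _≺_ C) → Maybe.All (_⊨ C) (unify-acc C C-acc)
  unify-acc-sound [] _ = Maybe.just []
  unify-acc-sound ((var α ≐ var β) ∷ C) (acc rs) with α ≟ β
  ... | yes refl = Maybe.map (refl ∷_) (unify-acc-sound C _)
  -- The inner `Maybe.map` turns satisfaction by the recursive result into satisfaction by its
  -- composite; `Maybe.map⁺` moves this to the mapped result.
  ... | no  α≢β  = Maybe.map⁺ (Maybe.map
          (λ {σ} σ⊨ → ↦-⊙-⊨ᶜ (var-∉ α≢β) σ ∷ ⊨-⊙ (α ↦ var β) σ σ⊨)
          (unify-acc-sound (applyᴸ (α ↦ var β) C) (rs (≺-substˡ (var-∉ α≢β) C))))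
  unify-acc-sound ((var α ≐ τ@(_ ⇒ _)) ∷ C) (acc rs) with α ∈? FTV τ
  ... | yes _   = Maybe.nothing
  ... | no  α∉τ = Maybe.map⁺ (Maybe.map
          (λ {σ} σ⊨ → ↦-⊙-⊨ᶜ α∉τ σ ∷ ⊨-⊙ (α ↦ τ) σ σ⊨)
          (unify-acc-sound (applyᴸ (α ↦ τ) C) (rs (≺-substˡ α∉τ C))))
  unify-acc-sound ((τ@(_ ⇒ _) ≐ var α) ∷ C) (acc rs) with α ∈? FTV τ
  ... | yes _   = Maybe.nothing
  ... | no  α∉τ = Maybe.map⁺ (Maybe.map
          (λ {σ} σ⊨ → sym (↦-⊙-⊨ᶜ α∉τ σ) ∷ ⊨-⊙ (α ↦ τ) σ σ⊨)
          (unify-acc-sound (applyᴸ (α ↦ τ) C) (rs (≺-substʳ α∉τ C))))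
  unify-acc-sound ((τ₁ ⇒ τ₂ ≐ τ₃ ⇒ τ₄) ∷ C) (acc rs) = Maybe.map
    (λ { (σ⊨₁₃ ∷ σ⊨₂₄ ∷ σ⊨C) → cong₂ _⇒_ σ⊨₁₃ σ⊨₂₄ ∷ σ⊨C })
    (unify-acc-sound ((τ₁ ≐ τ₃) ∷ (τ₂ ≐ τ₄) ∷ C) (rs (≺-split τ₁ τ₂ τ₃ τ₄ C)))

theorem2 : {Var : Set} (_≟_ : DecidableEquality Var) →
    let open Unification _≟_ in
    (C : List Constraint) (σ : Substitution) →
    Pointwise _≈_ (unify C) (just σ) → σ ⊨ C
theorem2 _≟_ C σ unify≈σ
  with Unification.unify _≟_ C
     | Soundness.unify-acc-sound _≟_ C (Unification.≺-wellFounded _≟_ C)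
     | unify≈σ
-- The hypothesis rules out failure, leaving a computed `σ′` that satisfies `C` and has the same
-- bindings as `σ`.
... | just _ | Maybe.just σ′⊨C | just σ′≈σ =
  All.map (λ {c} → Soundness.⊨ᶜ-resp-≈ _≟_ σ′≈σ c) σ′⊨C
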